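{- For every twin-free graph $G$ of order $n\geq 1$ with $n\notin\{8,9,16,17\}$, we have $\text{max-sep}_{RB}(G)\geq \lfloor\log_2(n)\rfloor$.
   Context: All graphs are finite, simple and undirected. $N[x]$ denotes the closed neighborhood of $x$. A graph is twin-free if no two distinct vertices have the same closed neighborhood. A red-blue coloring of $G$ is a map $c:V(G)\to\{\text{red},\text{blue}\}$. A red-blue separating set of $(G,c)$ is a set $S\subseteq V(G)$ such that $N[r]\cap S\neq N[b]\cap S$ for every red vertex $r$ and every blue vertex $b$. For $G$ twin-free, $\mathrm{sep}_{RB}(G,c)$ is the smallest size of a red-blue separating set of $(G,c)$, and $\text{max-sep}_{RB}(G)$ is the maximum of $\mathrm{sep}_{RB}(G,c)$ over all red-blue colorings $c$ of $G$. -}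

module Defs where

import Data.Bool.Properties as Bool
open import Data.Fin using (Fin)
open import Data.Fin.Properties using (_≟_; all?)
open import Data.Fin.Subset using (Subset; _∩_; ∣_∣; ⊤; inside; outside)
open import Data.Fin.Subset.Properties using (∣⊤∣≡n; ∩-identityʳ)
open import Data.List using (List; []; _∷_; map; filter; cartesianProductWith)
open import Data.List.Extrema.Nat using (min; max; min≤xs; argmin-sel; argmax-sel; max≤v⁺; v≤max⁺)
open import Data.List.Membership.Propositional using (_∈_; lose)
open import Data.List.Membership.Propositional.Properties
  using (∈-map⁺; ∈-map⁻; ∈-filter⁺; ∈-filter⁻; ∈-cartesianProductWith⁺)
open import Data.List.Relation.Unary.All as All using ()
open import Data.List.Relation.Unary.Any using (here; there)
open import Data.Nat using (ℕ; zero; suc; _≤_)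
open import Data.Nat.Properties using (≤-refl; n≤0⇒n≡0)
open import Data.Product using (∃-syntax; _×_; _,_)
open import Data.Sum using (_⊎_; inj₁; inj₂)
open import Data.Vec using (Vec; []; _∷_; lookup; tabulate; replicate)
open import Data.Vec.Properties using (≡-dec)
open import Function using (id)
open import Level using (0ℓ)
open import Relation.Binary using (Rel; Decidable; DecidableEquality; Symmetric; Irreflexive)
open import Relation.Binary.PropositionalEquality
  using (_≡_; _≢_; refl; sym; trans; subst)
open import Relation.Nullary using (Dec; yes; no; does; ¬?)
open import Relation.Nullary.Decidable using (_⊎-dec_; _→-dec_)

private
  variable
    n : ℕ

-- Adjacency is required to be decidable, so that neighborhoods are `Subset`s.
record Graph (n : ℕ) : Set₁ where
  field
    Adj    : Rel (Fin n) 0ℓ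
    adj?   : Decidable Adj
    symm   : Symmetric Adj
    irrefl : Irreflexive _≡_ Adj

  N[_] : Fin n → Subset n
  N[ x ] = tabulate λ y → does ((y ≟ x) ⊎-dec adj? x y)

TwinFree : Graph n → Set
TwinFree G = ∀ x y → x ≢ y → N[ x ] ≢ N[ y ]
  where open Graph G

data Color : Set where
  red blue : Color

_≟ᶜ_ : DecidableEquality Color
red  ≟ᶜ red  = yes refl
red  ≟ᶜ blue = no λ ()
blue ≟ᶜ red  = no λ ()
blue ≟ᶜ blue = yes refl

-- A map from the vertices to the colors, tabulated: the color of `x` is
-- `lookup c x`.
Coloring : ℕ → Set
Coloring = Vec Color

RBSeparating : Graph n → Coloring n → Subset n → Set
RBSeparating G c S =
  ∀ r b → lookup c r ≡ red → lookup c b ≡ blue → N[ r ] ∩ S ≢ N[ b ] ∩ S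
  where open Graph G

rbSeparating? : (G : Graph n) (c : Coloring n) (S : Subset n) → Dec (RBSeparating G c S)
rbSeparating? G c S = all? λ r → all? λ b →
  (lookup c r ≟ᶜ red) →-dec ((lookup c b ≟ᶜ blue) →-dec
    ¬? (≡-dec Bool._≟_ (N[ r ] ∩ S) (N[ b ] ∩ S)))
  where open Graph G

allVecs : {A : Set} → List A → (n : ℕ) → List (Vec A n)
allVecs as zero    = [] ∷ []
allVecs as (suc n) = cartesianProductWith _∷_ as (allVecs as n)

subsets : (n : ℕ) → List (Subset n)
subsets = allVecs (inside ∷ outside ∷ [])

colorings : (n : ℕ) → List (Coloring n)
colorings = allVecs (red ∷ blue ∷ [])

-- The first argument of `min` is an upper bound for the result; here it is the
-- order of G, which is the size of the red-blue separating set V(G) when G is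
-- twin-free. So for twin-free G this is the true minimum: see `sepRB-attained`
-- and `sepRB-minimal`.
sepRB : Graph n → Coloring n → ℕ
sepRB {n} G c = min n (map ∣_∣ (filter (rbSeparating? G c) (subsets n)))

max-sepRB : Graph n → ℕ
max-sepRB {n} G = max 0 (map (sepRB G) (colorings n))

allVecs-complete : {A : Set} {as : List A} → (∀ a → a ∈ as) →
                   (v : Vec A n) → v ∈ allVecs as n
allVecs-complete h []      = here refl
allVecs-complete h (a ∷ v) = ∈-cartesianProductWith⁺ _∷_ (h a) (allVecs-complete h v)

∈-subsets : (S : Subset n) → S ∈ subsets n
∈-subsets = allVecs-complete λ where
  inside  → here refl
  outside → there (here refl)

∈-colorings : (c : Coloring n) → c ∈ colorings n
∈-colorings = allVecs-complete λ where
  red  → here refl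
  blue → there (here refl)

⊤-separating : (G : Graph n) → TwinFree G → ∀ c → RBSeparating G c ⊤
⊤-separating G tf c r b cr cb eq = tf r b r≢b N≡N
  where
  open Graph G
  red≢blue : red ≢ blue
  red≢blue ()
  r≢b : r ≢ b
  r≢b refl = red≢blue (trans (sym cr) cb)
  N≡N : N[ r ] ≡ N[ b ]
  N≡N = trans (sym (∩-identityʳ N[ r ])) (trans eq (∩-identityʳ N[ b ]))

sepRB-minimal : (G : Graph n) (c : Coloring n) (S : Subset n) →
                RBSeparating G c S → sepRB G c ≤ ∣ S ∣
sepRB-minimal {n} G c S sep = All.lookup (min≤xs n _)
  (∈-map⁺ ∣_∣ (∈-filter⁺ (rbSeparating? G c) (∈-subsets S) sep))

sepRB-attained : (G : Graph n) → TwinFree G → (c : Coloring n) →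
                 ∃[ S ] RBSeparating G c S × ∣ S ∣ ≡ sepRB G c
sepRB-attained {n} G tf c
  with argmin-sel id n (map ∣_∣ (filter (rbSeparating? G c) (subsets n)))
... | inj₁ min≡n = ⊤ , ⊤-separating G tf c , trans (∣⊤∣≡n n) (sym min≡n)
... | inj₂ min∈ with S , S∈ , min≡∣S∣ ← ∈-map⁻ ∣_∣ min∈
                with _ , sep ← ∈-filter⁻ (rbSeparating? G c) {xs = subsets n} S∈
  = S , sep , sym min≡∣S∣

max-sepRB-maximal : (G : Graph n) (c : Coloring n) → sepRB G c ≤ max-sepRB G
max-sepRB-maximal {n} G c =
  v≤max⁺ 0 _ (inj₂ (lose (∈-map⁺ (sepRB G) (∈-colorings c)) ≤-refl))

max-sepRB-attained : (G : Graph n) → ∃[ c ] sepRB G c ≡ max-sepRB G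
max-sepRB-attained {n} G with argmax-sel id 0 (map (sepRB G) (colorings n))
... | inj₁ max≡0 = c₀ , trans (n≤0⇒n≡0 (subst (sepRB G c₀ ≤_) max≡0 (max-sepRB-maximal G c₀))) (sym max≡0)
  where c₀ = replicate n red
... | inj₂ max∈ with c , _ , max≡ ← ∈-map⁻ (sepRB G) max∈ = c , sym max≡

{-# OPTIONS --safe #-}
module Submission where

open import Data.Bool using (T; if_then_else_)
import Data.Bool.Properties as Bool
open import Data.Fin.Properties using (any?)
open import Data.Fin.Subset using (Subset; _∩_; ∣_∣; inside; outside)
open import Data.List
  using (List; []; _∷_; _++_; map; drop; length; concatMap; cartesianProductWith)
open import Data.List.Membership.Propositional using (_∈_; _∉_; lose)
open import Data.List.Membership.Propositional.Properties
  using (∈-concatMap⁺; ∈-map⁺; ∈-++⁺ˡ; ∈-++⁺ʳ)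
open import Data.List.Properties using (length-map; length-++; length-drop)
open import Data.List.Relation.Unary.All as All using (All; []; _∷_)
open import Data.List.Relation.Unary.All.Properties as All using ()
open import Data.List.Relation.Unary.Any as Any using (Any; here; there)
open import Data.List.Relation.Unary.Any.Properties as Any using ()
open import Data.Nat
  using (ℕ; zero; suc; _+_; _*_; _∸_; _^_; _≤_; _<_; _≥_; _<ᵇ_; _<?_;
         _≤′_; ≤′-refl; ≤′-step; ⌊_/2⌋; z≤n; s≤s)
open import Data.Nat.Induction using (Acc; acc; <-wellFounded)
open import Data.Nat.Logarithm using (⌊log₂_⌋)
open import Data.Nat.Logarithm.Core using (⌊log2⌋)
open import Data.Nat.Properties renaming (_≟_ to _≟ⁿ_)
open import Data.Nat.Tactic.RingSolver using (solve-∀)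
open import Data.Product using (∃₂; ∃-syntax; _×_; _,_)
open import Data.Vec using ([]; _∷_; lookup; tabulate; replicate; head; tail)
open import Data.Vec.Properties using (≡-dec; tabulate-cong; tabulate∘lookup)
open import Function using (_∘_)
open import Relation.Binary.PropositionalEquality
  using (_≡_; refl; sym; trans; cong; cong₂; subst; module ≡-Reasoning)
open import Relation.Nullary using (Dec; yes; no; contradiction)
open import Relation.Nullary.Decidable using (_×-dec_)
open import Defs

-- If every coloring had a red-blue separating set of size at most m, then
-- every coloring would be given by a set S with ∣S∣ ≤ m and a map assigning a
-- color to each of the 2^∣S∣ possible traces on S.  There are fewer than 2^n
-- such pairs once n ≥ 2^(m+1), unless n ∈ {4, 8, 9, 16, 17}.  For n = 4 the
-- count succeeds as well if the all-red coloring, which arises from every S, is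
-- counted only once.

private
  variable
    n : ℕ
    A B C : Set

-- Lengths of products and concatenations of lists.

length-cartesianProductWith : (f : A → B → C) (xs : List A) (ys : List B) →
  length (cartesianProductWith f xs ys) ≡ length xs * length ys
length-cartesianProductWith f []       ys = refl
length-cartesianProductWith f (x ∷ xs) ys = trans (length-++ (map (f x) ys))
  (cong₂ _+_ (length-map (f x) ys) (length-cartesianProductWith f xs ys))

length-concatMap-≤ : (f : A → List B) {b : ℕ} {xs : List A} →
  All (λ x → length (f x) ≤ b) xs → length (concatMap f xs) ≤ length xs * b
length-concatMap-≤ f []                   = z≤n
length-concatMap-≤ f (_∷_ {x = x} px pxs) = ≤-trans
  (≤-reflexive (length-++ (f x)))
  (+-mono-≤ px (length-concatMap-≤ f pxs))

-- Pigeonhole principle for colorings.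

tailsAfter : Color → List (Coloring (suc n)) → List (Coloring n)
tailsAfter a []             = []
tailsAfter a ((b ∷ v) ∷ vs) with a ≟ᶜ b
... | yes _ = v ∷ tailsAfter a vs
... | no  _ = tailsAfter a vs

∈-tailsAfter : ∀ {a} {v : Coloring n} {vs} → a ∷ v ∈ vs → v ∈ tailsAfter a vs
∈-tailsAfter {vs = (red  ∷ _) ∷ _} (here refl) = here refl
∈-tailsAfter {vs = (blue ∷ _) ∷ _} (here refl) = here refl
∈-tailsAfter {a = a} {vs = (b ∷ _) ∷ _} (there v∈) with a ≟ᶜ b
... | yes _ = there (∈-tailsAfter v∈)
... | no  _ = ∈-tailsAfter v∈

length-tailsAfter : (vs : List (Coloring (suc n))) →
  length (tailsAfter red vs) + length (tailsAfter blue vs) ≡ length vs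
length-tailsAfter []                = refl
length-tailsAfter ((red  ∷ _) ∷ vs) = cong suc (length-tailsAfter vs)
length-tailsAfter ((blue ∷ _) ∷ vs) = trans
  (+-suc (length (tailsAfter red vs)) _) (cong suc (length-tailsAfter vs))

-- The listed vectors split by first color, and both classes cannot have `2 ^ n` members; the
-- recursion follows a class that is too small.
missed-coloring : ∀ n (vs : List (Coloring n)) → length vs < 2 ^ n → ∃[ v ] v ∉ vs
missed-coloring zero    []      _            = [] , λ ()
missed-coloring zero    (_ ∷ _) (s≤s ())
missed-coloring (suc n) vs      few
  with length (tailsAfter red vs) <? 2 ^ n
... | yes fewRed with v , v∉ ← missed-coloring n (tailsAfter red vs) fewRed
  = red ∷ v , v∉ ∘ ∈-tailsAfter
... | no manyRed with v , v∉ ← missed-coloring n (tailsAfter blue vs) (≰⇒> λ manyBlue →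
    <⇒≱ few (subst (2 ^ suc n ≤_) (length-tailsAfter vs)
      (+-mono-≤ (≮⇒≥ manyRed) (≤-trans (≤-reflexive (+-identityʳ _)) manyBlue))))
  = blue ∷ v , v∉ ∘ ∈-tailsAfter

-- Subsets of bounded size.

smallSubsets : (n m : ℕ) → List (Subset n)
smallSubsets zero    m       = [] ∷ []
smallSubsets (suc n) zero    = map (outside ∷_) (smallSubsets n zero)
smallSubsets (suc n) (suc m) =
  map (outside ∷_) (smallSubsets n (suc m)) ++ map (inside ∷_) (smallSubsets n m)

∈-smallSubsets : ∀ {m} (S : Subset n) → ∣ S ∣ ≤ m → S ∈ smallSubsets n m
∈-smallSubsets             []            _         = here refl
∈-smallSubsets {m = zero}  (outside ∷ S) S≤m       = ∈-map⁺ _ (∈-smallSubsets S S≤m)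
∈-smallSubsets {m = suc m} (outside ∷ S) S≤m       = ∈-++⁺ˡ (∈-map⁺ _ (∈-smallSubsets S S≤m))
∈-smallSubsets {m = suc m} (inside  ∷ S) (s≤s S≤m) = ∈-++⁺ʳ _ (∈-map⁺ _ (∈-smallSubsets S S≤m))

smallSubsets-small : ∀ n m → All (λ S → ∣ S ∣ ≤ m) (smallSubsets n m)
smallSubsets-small zero    m       = z≤n ∷ []
smallSubsets-small (suc n) zero    = All.map⁺ (smallSubsets-small n zero)
smallSubsets-small (suc n) (suc m) = All.++⁺
  (All.map⁺ (smallSubsets-small n (suc m)))
  (All.map⁺ (All.map s≤s (smallSubsets-small n m)))

-- The volume of a Hamming ball, i.e. the sum of the binomial coefficients C(n, i) over i ≤ m,
-- computed by Pascal's rule.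
ball : (n m : ℕ) → ℕ
ball n       zero    = 1
ball zero    (suc m) = 1
ball (suc n) (suc m) = ball n (suc m) + ball n m

length-smallSubsets : ∀ n m → length (smallSubsets n m) ≡ ball n m
length-smallSubsets zero    zero    = refl
length-smallSubsets zero    (suc m) = refl
length-smallSubsets (suc n) zero    =
  trans (length-map _ (smallSubsets n zero)) (length-smallSubsets n zero)
length-smallSubsets (suc n) (suc m) = trans
  (length-++ (map (outside ∷_) (smallSubsets n (suc m))))
  (cong₂ _+_
    (trans (length-map _ (smallSubsets n (suc m))) (length-smallSubsets n (suc m)))
    (trans (length-map _ (smallSubsets n m)) (length-smallSubsets n m)))

-- Color rules that depend only on the trace on S.

branch : (g h : Subset n → Color) → Subset (suc n) → Color
branch g h T = if head T then g (tail T) else h (tail T)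

-- All the functions T ↦ f (T ∩ S).
rules : Subset n → List (Subset n → Color)
rules []            = (λ _ → red) ∷ (λ _ → blue) ∷ []
rules (outside ∷ S) = map (_∘ tail) (rules S)
rules (inside  ∷ S) = cartesianProductWith branch (rules S) (rules S)

length-rules : (S : Subset n) → length (rules S) ≡ 2 ^ (2 ^ ∣ S ∣)
length-rules []            = refl
length-rules (outside ∷ S) = trans (length-map _ (rules S)) (length-rules S)
length-rules (inside  ∷ S) = begin
  length (rules (inside ∷ S))                 ≡⟨ length-cartesianProductWith branch (rules S) _ ⟩
  length (rules S) * length (rules S)         ≡⟨ cong₂ _*_ (length-rules S) (length-rules S) ⟩
  2 ^ (2 ^ ∣ S ∣) * 2 ^ (2 ^ ∣ S ∣)           ≡⟨ ^-distribˡ-+-* 2 (2 ^ ∣ S ∣) _ ⟨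
  2 ^ (2 ^ ∣ S ∣ + 2 ^ ∣ S ∣)                 ≡⟨ cong (λ i → 2 ^ (2 ^ ∣ S ∣ + i)) (+-identityʳ _) ⟨
  2 ^ (2 ^ ∣ S ∣ + (2 ^ ∣ S ∣ + 0))           ∎
  where open ≡-Reasoning

rules-complete : (S : Subset n) (f : Subset n → Color) →
  Any (λ g → ∀ T → g T ≡ f (T ∩ S)) (rules S)
rules-complete [] f with f [] in eq
... | red  = here λ { [] → sym eq }
... | blue = there (here λ { [] → sym eq })
rules-complete (outside ∷ S) f = Any.map⁺ (Any.map (λ {g} → extend {g}) (rules-complete S (f ∘ (outside ∷_))))
  where
  extend : ∀ {g} → (∀ T → g T ≡ f (outside ∷ T ∩ S)) → ∀ T → g (tail T) ≡ f (T ∩ (outside ∷ S))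
  extend eq (b ∷ T) = trans (eq T) (cong (λ b′ → f (b′ ∷ T ∩ S)) (sym (Bool.∧-zeroʳ b)))
rules-complete (inside ∷ S) f = Any.cartesianProductWith⁺ branch combine
  (rules-complete S (f ∘ (inside ∷_))) (rules-complete S (f ∘ (outside ∷_)))
  where
  combine : ∀ {g h} → (∀ T → g T ≡ f (inside ∷ T ∩ S)) → (∀ T → h T ≡ f (outside ∷ T ∩ S)) →
            ∀ T → branch g h T ≡ f (T ∩ (inside ∷ S))
  combine eqᵍ eqʰ (inside  ∷ T) = eqᵍ T
  combine eqᵍ eqʰ (outside ∷ T) = eqʰ T

-- Guarantees that `drop 1` in `candidates` removes a rule that paints everything red, whatever S
-- is.
rules-red : (S : Subset n) → ∃₂ λ g gs → rules S ≡ g ∷ gs × (∀ T → g T ≡ red)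
rules-red []            = _ , _ , refl , λ _ → refl
rules-red (outside ∷ S) with g , gs , eq , g≡red ← rules-red S
  rewrite eq = _ , _ , refl , g≡red ∘ tail
rules-red (inside  ∷ S) with g , gs , eq , g≡red ← rules-red S
  rewrite eq = _ , _ , refl , λ where
    (inside  ∷ T) → g≡red T
    (outside ∷ T) → g≡red T

-- Colorings that have a small separating set.

module _ (G : Graph n) where
  open Graph G

  paint : (Subset n → Color) → Coloring n
  paint g = tabulate (g ∘ N[_])

  -- `drop 1` discards the rule that makes all vertices red.
  candidates : ℕ → List (Coloring n)
  candidates m = replicate n red ∷
    concatMap (λ S → map paint (drop 1 (rules S))) (smallSubsets n m)

  -- A trace is declared red when some red vertex has it, and blue by default. Separation ensures
  -- that no blue vertex has a trace declared red, so the rule reproduces `c`.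
  separated⇒painted : ∀ c S → RBSeparating G c S → Any (λ g → paint g ≡ c) (rules S)
  separated⇒painted c S sep = Any.map paints (rules-complete S color)
    where
    redTrace? : ∀ U → Dec (∃[ r ] lookup c r ≡ red × N[ r ] ∩ S ≡ U)
    redTrace? U = any? λ r → (lookup c r ≟ᶜ red) ×-dec ≡-dec Bool._≟_ (N[ r ] ∩ S) U

    color : Subset n → Color
    color U with redTrace? U
    ... | yes _ = red
    ... | no  _ = blue

    color-trace : ∀ x → color (N[ x ] ∩ S) ≡ lookup c x
    color-trace x with redTrace? (N[ x ] ∩ S) | lookup c x in cx
    ... | yes _            | red  = refl
    ... | yes (r , cr , e) | blue = contradiction e (sep r x cr cx)
    ... | no  none         | red  = contradiction (x , cx , refl) none
    ... | no  _            | blue = refl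

    paints : ∀ {g} → (∀ T → g T ≡ color (T ∩ S)) → paint g ≡ c
    paints eq = trans (tabulate-cong (λ x → trans (eq N[ x ]) (color-trace x)))
                      (tabulate∘lookup c)

  tabulate-red : ∀ {k} → tabulate {n = k} (λ _ → red) ≡ replicate k red
  tabulate-red {zero}  = refl
  tabulate-red {suc k} = cong (red ∷_) tabulate-red

  ∈-candidates : ∀ m c S → ∣ S ∣ ≤ m → RBSeparating G c S → c ∈ candidates m
  ∈-candidates m c S S≤m sep
    with g , gs , eq , g≡red ← rules-red S
    with subst (Any _) eq (separated⇒painted c S sep)
  ... | here g↦c  = here (trans (sym g↦c) (trans (tabulate-cong (g≡red ∘ N[_])) tabulate-red))
  ... | there gs↦c = there (∈-concatMap⁺ _ (lose (∈-smallSubsets S S≤m)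
    (subst (λ hs → c ∈ map paint (drop 1 hs)) (sym eq) (Any.map⁺ (Any.map sym gs↦c)))))

  -- Every small S is charged as if it had size m and kept all its rules; the `suc` is the all-red
  -- coloring.
  length-candidates : ∀ m → length (candidates m) ≤ suc (ball n m * 2 ^ (2 ^ m))
  length-candidates m = s≤s (≤-trans
    (length-concatMap-≤ _ (All.map (λ {S} → bound S) (smallSubsets-small n m)))
    (≤-reflexive (cong (_* 2 ^ (2 ^ m)) (length-smallSubsets n m))))
    where
    open ≤-Reasoning
    bound : ∀ S → ∣ S ∣ ≤ m → length (map paint (drop 1 (rules S))) ≤ 2 ^ (2 ^ m)
    bound S S≤m = begin
      length (map paint (drop 1 (rules S))) ≡⟨ length-map paint (drop 1 (rules S)) ⟩
      length (drop 1 (rules S))             ≡⟨ length-drop 1 (rules S) ⟩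
      length (rules S) ∸ 1                  ≤⟨ m∸n≤m _ 1 ⟩
      length (rules S)                      ≡⟨ length-rules S ⟩
      2 ^ (2 ^ ∣ S ∣)                       ≤⟨ ^-monoʳ-≤ 2 (^-monoʳ-≤ 2 S≤m) ⟩
      2 ^ (2 ^ m)                           ∎

  -- A coloring missing from the list needs more than m vertices, since a smallest separating set of
  -- size at most m would put it there.
  few-candidates⇒max-sepRB> : TwinFree G → ∀ m → length (candidates m) < 2 ^ n → m < max-sepRB G
  few-candidates⇒max-sepRB> tf m few with c , c∉ ← missed-coloring n (candidates m) few
    with m <? sepRB G c
  ... | yes m<sep = <-≤-trans m<sep (max-sepRB-maximal G c)
  ... | no  m≮sep with S , sep , ∣S∣≡ ← sepRB-attained G tf c =
    contradiction (∈-candidates m c S (≤-trans (≤-reflexive ∣S∣≡) (≮⇒≥ m≮sep)) sep) c∉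

-- Bounds on Hamming balls.

ball-monoʳ : ∀ n m → ball n m ≤ ball n (suc m)
ball-monoʳ zero    zero    = ≤-refl
ball-monoʳ zero    (suc m) = ≤-refl
ball-monoʳ (suc n) zero    = ≤-trans (ball-monoʳ n zero) (m≤m+n _ _)
ball-monoʳ (suc n) (suc m) = +-mono-≤ (ball-monoʳ n (suc m)) (ball-monoʳ n m)

ball-double : ∀ n m → ball (suc n) m ≤ 2 * ball n m
ball-double n zero    = s≤s z≤n
ball-double n (suc m) =
  +-monoʳ-≤ (ball n (suc m)) (≤-trans (ball-monoʳ n m) (m≤m+n _ 0))

ball≤^ : ∀ n m → ball n m ≤ suc n ^ m
ball≤^ n       zero    = ≤-refl
ball≤^ zero    (suc m) = ≤-reflexive (sym (^-zeroˡ (suc m)))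
ball≤^ (suc n) (suc m) = begin
  ball n (suc m) + ball n m        ≤⟨ +-mono-≤ (ball≤^ n (suc m)) (ball≤^ n m) ⟩
  suc n * suc n ^ m + suc n ^ m    ≡⟨ +-comm (suc n * suc n ^ m) _ ⟩
  suc (suc n) * suc n ^ m          ≤⟨ *-monoʳ-≤ (suc (suc n)) (^-monoˡ-≤ m (n≤1+n (suc n))) ⟩
  suc (suc n) * suc (suc n) ^ m    ∎
  where open ≤-Reasoning

-- The counting inequality `Room`.

Room : ℕ → ℕ → Set
Room m n = suc (ball n m * 2 ^ (2 ^ m)) < 2 ^ n

-- Each step in n doubles the right side and at most doubles the ball; doubling the `suc` leaves 1
-- to spare.
room-mono : ∀ {m n n′} → n ≤ n′ → Room m n → Room m n′
room-mono {m} n≤n′ = go (≤⇒≤′ n≤n′)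
  where
  open ≤-Reasoning
  M = 2 ^ (2 ^ m)
  go : ∀ {n n′} → n ≤′ n′ → Room m n → Room m n′
  go ≤′-refl             r = r
  go (≤′-step {n} n≤′n′) r = begin-strict
    suc (ball (suc n) m * M)  ≤⟨ s≤s (*-monoˡ-≤ M (ball-double n m)) ⟩
    suc (2 * ball n m * M)    ≡⟨ cong suc (*-assoc 2 (ball n m) M) ⟩
    suc (2 * (ball n m * M))  ≤⟨ n≤1+n _ ⟩
    2 + 2 * (ball n m * M)    ≡⟨ *-suc 2 (ball n m * M) ⟨
    2 * suc (ball n m * M)    <⟨ *-monoʳ-< 2 (go n≤′n′ r) ⟩
    2 ^ suc n                 ∎

-- With M = `2 ^ (2 ^ m)`, the right side of `Room` is M * M, so it is enough that the ball plus 1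
-- is at most M. The lone 1 is absorbed by 1 < M.
room-power : ∀ m → suc (suc (2 ^ suc m) ^ m) ≤ 2 ^ (2 ^ m) → Room m (2 ^ suc m)
room-power m h = begin-strict
  1 + ball N m * M     <⟨ +-monoˡ-< (ball N m * M) (^-monoʳ-≤ 2 {1} (m^n>0 2 m)) ⟩
  M + ball N m * M     ≤⟨ *-monoˡ-≤ M (≤-trans (s≤s (ball≤^ N m)) h) ⟩
  M * M                ≡⟨ ^-distribˡ-+-* 2 (2 ^ m) (2 ^ m) ⟨
  2 ^ (2 ^ m + 2 ^ m)  ≡⟨ cong (λ i → 2 ^ (2 ^ m + i)) (+-identityʳ _) ⟨
  2 ^ N                ∎
  where
  open ≤-Reasoning
  N = 2 ^ suc m
  M = 2 ^ (2 ^ m)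

square<power : ∀ j → suc ((8 + j) * (6 + j)) ≤ 2 ^ (6 + j)
-- The exponent 6 is the least possible start: for 5 the claim would be 36 ≤ 32.
square<power zero    = ≤ᵇ⇒≤ 49 64 _
square<power (suc j) = begin
  -- The added polynomial is the exact gap to twice the previous left side.
  suc ((8 + suc j) * (6 + suc j))                         ≤⟨ m≤m+n _ (34 + 12 * j + j * j) ⟩
  suc ((8 + suc j) * (6 + suc j)) + (34 + 12 * j + j * j) ≡⟨ identity j ⟩
  2 * suc ((8 + j) * (6 + j))                             ≤⟨ *-monoʳ-≤ 2 (square<power j) ⟩
  2 ^ (6 + suc j)                                         ∎
  where
  open ≤-Reasoning
  identity : ∀ j → suc ((8 + suc j) * (6 + suc j)) + (34 + 12 * j + j * j)
                 ≡ 2 * suc ((8 + j) * (6 + j))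
  identity = solve-∀

room-large : ∀ j → let m = 6 + j in Room m (2 ^ suc m)
room-large j = room-power m (begin
  -- Rounding `1 + 2 ^ suc m` up to `2 ^ (2 + m)` leaves a comparison of exponents.
  suc (suc (2 ^ suc m) ^ m)      ≤⟨ s≤s (^-monoˡ-≤ m (+-monoˡ-≤ (2 ^ suc m) (m^n>0 2 (suc m)))) ⟩
  suc ((2 ^ suc m + 2 ^ suc m) ^ m) ≡⟨ cong (λ i → suc ((2 ^ suc m + i) ^ m)) (+-identityʳ _) ⟨
  suc ((2 ^ (2 + m)) ^ m)        ≡⟨ cong suc (^-*-assoc 2 (2 + m) m) ⟩
  1 + 2 ^ ((2 + m) * m)          ≤⟨ +-mono-≤ (m^n>0 2 ((2 + m) * m)) (m≤m+n _ 0) ⟩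
  2 ^ suc ((2 + m) * m)          ≤⟨ ^-monoʳ-≤ 2 (square<power j) ⟩
  2 ^ (2 ^ m)                    ∎)
  where
  open ≤-Reasoning
  m = 6 + j

-- For numerals m and k the implicit `T` argument is settled by evaluation.
room-from : ∀ m k {n} → {T (suc (ball k m * 2 ^ (2 ^ m)) <ᵇ 2 ^ k)} → k ≤ n → Room m n
room-from m k {n} {t} k≤n = room-mono {m} k≤n (<ᵇ⇒< _ _ t)

room-from-power : ∀ m {n} → {T (suc (2 ^ suc m) ^ m <ᵇ 2 ^ (2 ^ m))} → 2 ^ suc m ≤ n → Room m n
room-from-power m {n} {t} 2^≤n = room-mono {m} 2^≤n (room-power m (<ᵇ⇒< _ _ t))

room : ∀ m {n} → n ∉ (4 ∷ 8 ∷ 9 ∷ 16 ∷ 17 ∷ []) → 2 ^ suc m ≤ n → Room m n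
room 0 n∉ 2≤n  = room-from 0 2 2≤n
-- The thresholds 5, 10 and 18 are the first orders at which the inequality holds for m = 1, 2, 3;
-- the excluded orders are those between `2 ^ suc m` and the threshold.
room 1 n∉ 4≤n  = room-from 1 5 (≤∧≢⇒< 4≤n (n∉ ∘ here ∘ sym))
room 2 n∉ 8≤n  = room-from 2 10
  (≤∧≢⇒< (≤∧≢⇒< 8≤n (n∉ ∘ there ∘ here ∘ sym)) (n∉ ∘ there ∘ there ∘ here ∘ sym))
room 3 n∉ 16≤n = room-from 3 18
  (≤∧≢⇒< (≤∧≢⇒< 16≤n (n∉ ∘ there ∘ there ∘ there ∘ here ∘ sym))
    (n∉ ∘ there ∘ there ∘ there ∘ there ∘ here ∘ sym))
-- The exact ball is used, as the power bound `33 ^ 4` exceeds `2 ^ 16`.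
room 4 n∉ 32≤n = room-from 4 32 32≤n
-- Here `65 ^ 5` is below `2 ^ 32`, so the ball need not be evaluated.
room 5 n∉ 64≤n = room-from-power 5 64≤n
room (suc (suc (suc (suc (suc (suc j)))))) n∉ 2^≤n =
  room-mono {6 + j} 2^≤n (room-large j)

-- The logarithm, order 4 and the conclusion.

2^⌊log2⌋n≤n : ∀ n (a : Acc _<_ n) → n ≥ 1 → 2 ^ ⌊log2⌋ n a ≤ n
2^⌊log2⌋n≤n (suc zero)    _        _ = ≤-refl
2^⌊log2⌋n≤n (suc (suc n)) (acc rs) _ = begin
  2 * 2 ^ ⌊log2⌋ (suc ⌊ n /2⌋) _ ≤⟨ *-monoʳ-≤ 2 (2^⌊log2⌋n≤n (suc ⌊ n /2⌋) _ (s≤s z≤n)) ⟩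
  2 * suc ⌊ n /2⌋                ≡⟨ *-suc 2 ⌊ n /2⌋ ⟩
  2 + 2 * ⌊ n /2⌋                ≡⟨ cong (λ i → 2 + (⌊ n /2⌋ + i)) (+-identityʳ _) ⟩
  2 + (⌊ n /2⌋ + ⌊ n /2⌋)        ≤⟨ +-monoʳ-≤ 2 (+-monoʳ-≤ ⌊ n /2⌋ (⌊n/2⌋≤⌈n/2⌉ n)) ⟩
  2 + (⌊ n /2⌋ + ⌊ suc n /2⌋)    ≡⟨ cong (2 +_) (⌊n/2⌋+⌈n/2⌉≡n n) ⟩
  2 + n                          ∎
  where open ≤-Reasoning

max-sepRB-order-4 : (G : Graph 4) → TwinFree G → max-sepRB G ≥ 2
max-sepRB-order-4 G tf = few-candidates⇒max-sepRB> G tf 1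
  (≤-<-trans (≤-reflexive length≡14) (<ᵇ⇒< 14 16 _))
  where
  -- All-red, one more rule for the empty set, and three for each of four singletons: 1 + 1 + 4 * 3.
  -- The length does not depend on the edges, so it computes for a variable `G`.
  length≡14 : length (candidates G 1) ≡ 14
  length≡14 = refl

2^k≤n⇒k≤max-sepRB : ∀ k → 2 ^ k ≤ n → n ∉ (4 ∷ 8 ∷ 9 ∷ 16 ∷ 17 ∷ []) →
  (G : Graph n) → TwinFree G → k ≤ max-sepRB G
2^k≤n⇒k≤max-sepRB zero    _    _  G tf = z≤n
2^k≤n⇒k≤max-sepRB (suc m) 2^≤n n∉ G tf = few-candidates⇒max-sepRB> G tf m
  (≤-<-trans (length-candidates G m) (room m n∉ 2^≤n))

theorem8 : (n : ℕ) → n ≥ 1 → n ∉ (8 ∷ 9 ∷ 16 ∷ 17 ∷ []) →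
    (G : Graph n) → TwinFree G → max-sepRB G ≥ ⌊log₂ n ⌋
theorem8 n n≥1 n∉ G tf = by-order (n ≟ⁿ 4)
  where
  by-order : Dec (n ≡ 4) → ⌊log₂ n ⌋ ≤ max-sepRB G
  by-order (yes refl) = max-sepRB-order-4 G tf
  by-order (no  n≢4)  = 2^k≤n⇒k≤max-sepRB ⌊log₂ n ⌋ (2^⌊log2⌋n≤n n (<-wellFounded n) n≥1)
    (λ { (here n≡4) → n≢4 n≡4 ; (there n∈) → n∉ n∈ }) G tf
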